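{- Let $G$ be a minimal $(3,3)$-Ramsey graph with $\omega(G) = 3$. Then $\delta(G) \geq 8$. Moreover, if $v \in V(G)$ and $d(v) = 8$, then $G(v)$ is isomorphic to $N_{8.i}$ for some $i \in \{1,\dots,7\}$.
   Context: All graphs are finite, undirected, without loops or multiple edges. $\omega(G)$ is the clique number, $\delta(G)$ the minimum degree, $d(v)$ the degree of $v$, and $G(v)$ the subgraph of $G$ induced by the set of neighbors of $v$. A graph $G$ is a $(3,3)$-Ramsey graph, written $G \rightarrow (3,3)$, if every coloring of the edges of $G$ with two colors contains a monochromatic triangle. $G$ is a minimal $(3,3)$-Ramsey graph if $G \rightarrow (3,3)$ and no proper subgraph $H$ of $G$ satisfies $H \rightarrow (3,3)$. A 2-coloring of the edges of a graph is $(3,3)$-free if it has no monochromatic triangle. For a graph $N$, the set $V(N)$ is a marked vertex set in $N$ if there is a $(3,3)$-free 2-coloring of the edges of $N$ which cannot be extended to a $(3,3)$-free 2-coloring of the edges of the graph obtained from $N$ by adding a new vertex adjacent to all vertices of $N$. $N_{8.1},\dots,N_{8.7}$ denote the 8-vertex triangle-free graphs $N$ for which $V(N)$ is a marked vertex set in $N$; up to isomorphism there are exactly seven such graphs. -}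

module Defs where

open import Data.Bool using (Bool; true; false; T; if_then_else_; _∧_; _∨_; not)
open import Data.Bool.Properties using (∨-comm; T?)
import Data.Bool.Properties as Bool
open import Data.Fin using (Fin; toℕ; _≟_)
open import Data.Fin.Patterns using (0F; 1F; 2F; 3F; 4F; 5F; 6F)
import Data.Fin.Properties as Fin
open import Data.Fin.Subset using (Subset; _∈_; _∉_; ∣_∣)
open import Data.Fin.Subset.Properties using (anySubset?)
open import Data.List using (List; []; _∷_; map; allFin; _++_)
open import Data.Bool.ListAction using (any)
open import Data.List.Extrema.Nat using (min)
open import Data.Maybe using (Maybe; just; nothing)
open import Data.Nat using (ℕ; zero; suc; _≤_; _≡ᵇ_)
import Data.Nat.Properties as ℕ
open import Data.Product using (Σ; ∃; ∃₂; _×_; _,_; proj₁; proj₂)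
open import Data.Sum using (_⊎_)
open import Data.Vec using (tabulate; lookup)
open import Data.Vec.Properties using (lookup∘tabulate)
open import Function using (_↔_; Inverse)
open import Relation.Binary.PropositionalEquality
  using (_≡_; _≢_; refl; sym; trans; cong; cong₂)
open import Relation.Nullary using (¬_; Dec)
open import Relation.Nullary.Decidable
  using (¬?; _×-dec_; _→-dec_; from-yes; decidable-stable)
open import Algebra.Properties.CommutativeMonoid.Sum ℕ.+-0-commutativeMonoid
  using (sum; sum-permute; sum-cong-≗)

-- The vertex type is a parameter so that induced subgraphs, subgraphs and
-- one-vertex extensions need no renumbering of vertices.  Finite graphs are
-- those with vertex type Fin n.

record Graph (V : Set) : Set where
  field
    adj        : V → V → Bool
    adj-sym    : ∀ u v → adj u v ≡ adj v u
    adj-irrefl : ∀ v → adj v v ≡ false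

  Adj : V → V → Set
  Adj u v = T (adj u v)

open Graph public

infix 4 _≅_

record _≅_ {V W : Set} (G : Graph V) (H : Graph W) : Set where
  field
    bijection : V ↔ W
    preserves : ∀ u v →
      adj G u v ≡ adj H (Inverse.to bijection u) (Inverse.to bijection v)

neighbours : ∀ {n} → Graph (Fin n) → Fin n → Subset n
neighbours G v = tabulate (adj G v)

degree : ∀ {n} → Graph (Fin n) → Fin n → ℕ
degree G v = ∣ neighbours G v ∣

-- Every degree is below n, so the default value n of min is irrelevant as soon
-- as there is a vertex.
δ : ∀ {n} → Graph (Fin n) → ℕ
δ {n} G = min n (map (degree G) (allFin n))

induced : ∀ {n} → Graph (Fin n) → (S : Subset n) → Graph (∃ (_∈ S))
induced G S = record
  { adj        = λ x y → adj G (proj₁ x) (proj₁ y)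
  ; adj-sym    = λ x y → adj-sym G (proj₁ x) (proj₁ y)
  ; adj-irrefl = λ x → adj-irrefl G (proj₁ x)
  }

-- G ⟨ v ⟩ is the graph written G(v) in the literature.
_⟨_⟩ : ∀ {n} (G : Graph (Fin n)) (v : Fin n) → Graph (∃ (_∈ neighbours G v))
G ⟨ v ⟩ = induced G (neighbours G v)

IsClique : ∀ {n} → Graph (Fin n) → Subset n → Set
IsClique G S = ∀ u v → u ∈ S → v ∈ S → u ≢ v → Adj G u v

-- CliqueNumber G k is the statement ω(G) = k.
record CliqueNumber {n} (G : Graph (Fin n)) (k : ℕ) : Set where
  field
    attained : ∃ λ S → IsClique G S × ∣ S ∣ ≡ k
    maximal  : ∀ S → IsClique G S → ∣ S ∣ ≤ k

TriangleFree : ∀ {V} → Graph V → Set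
TriangleFree G = ∀ u v w → ¬ (Adj G u v × Adj G v w × Adj G u w)

-- A 2-colouring of the edges.  The law for colour says that the colour of an
-- edge depends neither on its orientation nor on the proof of adjacency.
record Colouring {V : Set} (G : Graph V) : Set where
  field
    colour     : ∀ u v → Adj G u v → Bool
    colour-sym : ∀ u v (e : Adj G u v) (e′ : Adj G v u) →
                 colour u v e ≡ colour v u e′

open Colouring public

MonochromaticTriangle : ∀ {V} {G : Graph V} → Colouring G → Set
MonochromaticTriangle {V} {G} c =
  Σ V λ u → Σ V λ v → Σ V λ w →
  Σ (Adj G u v) λ uv → Σ (Adj G v w) λ vw → Σ (Adj G u w) λ uw →
  colour c u v uv ≡ colour c v w vw × colour c u v uv ≡ colour c u w uw

-- (3,3)-free colourings
Free : ∀ {V} {G : Graph V} → Colouring G → Set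
Free c = ¬ MonochromaticTriangle c

-- G → (3,3)
Ramsey : ∀ {V} → Graph V → Set
Ramsey G = (c : Colouring G) → MonochromaticTriangle c

record Subgraph {n} (G : Graph (Fin n)) : Set where
  field
    vertices : Subset n
    graph    : Graph (∃ (_∈ vertices))
    edges    : ∀ x y → Adj graph x y → Adj G (proj₁ x) (proj₁ y)

open Subgraph public

-- A subgraph is proper if it misses a vertex or an edge.
Proper : ∀ {n} {G : Graph (Fin n)} → Subgraph G → Set
Proper {G = G} H =
  (∃ λ v → v ∉ vertices H) ⊎
  (∃₂ λ x y → Adj G (proj₁ x) (proj₁ y) × ¬ Adj (graph H) x y)

record MinimalRamsey {n} (G : Graph (Fin n)) : Set where
  field
    ramsey  : Ramsey G
    minimal : (H : Subgraph G) → Proper H → ¬ Ramsey (graph H)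

-- The graph obtained from N by adding a vertex, here nothing, adjacent to all
-- vertices of N.
cone : ∀ {V} → Graph V → Graph (Maybe V)
cone {V} N = record { adj = a ; adj-sym = a-sym ; adj-irrefl = a-irrefl }
  where
  a : Maybe V → Maybe V → Bool
  a nothing  nothing  = false
  a nothing  (just _) = true
  a (just _) nothing  = true
  a (just u) (just v) = adj N u v

  a-sym : ∀ x y → a x y ≡ a y x
  a-sym nothing  nothing  = refl
  a-sym nothing  (just _) = refl
  a-sym (just _) nothing  = refl
  a-sym (just u) (just v) = adj-sym N u v

  a-irrefl : ∀ x → a x x ≡ false
  a-irrefl nothing  = refl
  a-irrefl (just v) = adj-irrefl N v

Extends : ∀ {V} {N : Graph V} → Colouring (cone N) → Colouring N → Set
Extends {N = N} c′ c =
  ∀ u v (e : Adj N u v) → colour c′ (just u) (just v) e ≡ colour c u v e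

-- V(N) is a marked vertex set in N.
Marked : ∀ {V} → Graph V → Set
Marked N = Σ (Colouring N) λ c →
  Free c × ((c′ : Colouring (cone N)) → Extends c′ c → ¬ Free c′)

-- The pairs of labels are read as unordered pairs; loops are discarded.
fromEdges : ∀ {n} → List (ℕ × ℕ) → Graph (Fin n)
fromEdges {n} es = record { adj = a ; adj-sym = a-sym ; adj-irrefl = a-irrefl }
  where
  joins : ℕ → ℕ → ℕ × ℕ → Bool
  joins u v (x , y) = (u ≡ᵇ x) ∧ (v ≡ᵇ y) ∨ (v ≡ᵇ x) ∧ (u ≡ᵇ y)

  a : Fin n → Fin n → Bool
  a u v = not (toℕ u ≡ᵇ toℕ v) ∧ any (joins (toℕ u) (toℕ v)) es

  ≡ᵇ-sym : ∀ u v → (u ≡ᵇ v) ≡ (v ≡ᵇ u)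
  ≡ᵇ-sym zero    zero    = refl
  ≡ᵇ-sym zero    (suc v) = refl
  ≡ᵇ-sym (suc u) zero    = refl
  ≡ᵇ-sym (suc u) (suc v) = ≡ᵇ-sym u v

  ≡ᵇ-refl : ∀ u → (u ≡ᵇ u) ≡ true
  ≡ᵇ-refl zero    = refl
  ≡ᵇ-refl (suc u) = ≡ᵇ-refl u

  any-sym : ∀ u v xs → any (joins u v) xs ≡ any (joins v u) xs
  any-sym u v []             = refl
  any-sym u v ((x , y) ∷ xs) = cong₂ _∨_
    (∨-comm ((u ≡ᵇ x) ∧ (v ≡ᵇ y)) ((v ≡ᵇ x) ∧ (u ≡ᵇ y))) (any-sym u v xs)

  a-sym : ∀ u v → a u v ≡ a v u
  a-sym u v = cong₂ _∧_ (cong not (≡ᵇ-sym (toℕ u) (toℕ v)))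
                        (any-sym (toℕ u) (toℕ v) es)

  a-irrefl : ∀ v → a v v ≡ false
  a-irrefl v = cong (λ b → not b ∧ any (joins (toℕ v) (toℕ v)) es) (≡ᵇ-refl (toℕ v))

-- The edges of the seven graphs, split into the two colour classes (true and
-- false) of a colouring that has no (3,3)-free extension to the cone.
N₈-true N₈-false : Fin 7 → List (ℕ × ℕ)
N₈-true 0F = (0 , 4) ∷ (1 , 6) ∷ (2 , 6) ∷ (3 , 7) ∷ (5 , 7) ∷ []
N₈-true 1F = (0 , 4) ∷ (1 , 4) ∷ (2 , 7) ∷ (3 , 7) ∷ (5 , 6) ∷ []
N₈-true 2F = (0 , 3) ∷ (1 , 6) ∷ (2 , 5) ∷ (2 , 6) ∷ (3 , 7) ∷ (4 , 7) ∷ []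
N₈-true 3F = (0 , 4) ∷ (0 , 5) ∷ (1 , 6) ∷ (2 , 6) ∷ (3 , 7) ∷ (5 , 7) ∷ []
N₈-true 4F = (0 , 3) ∷ (0 , 5) ∷ (1 , 5) ∷ (1 , 7) ∷ (2 , 6) ∷ (2 , 7) ∷ (4 , 6) ∷ []
N₈-true 5F = (0 , 4) ∷ (0 , 5) ∷ (1 , 4) ∷ (1 , 6) ∷ (2 , 6) ∷ (3 , 7) ∷ (5 , 7) ∷ []
N₈-true 6F = (0 , 3) ∷ (0 , 4) ∷ (1 , 5) ∷ (1 , 6) ∷ (2 , 5) ∷ (2 , 6) ∷ (3 , 7) ∷ (4 , 7) ∷ []

N₈-false 0F = (0 , 6) ∷ (1 , 5) ∷ (2 , 7) ∷ (3 , 6) ∷ (4 , 7) ∷ []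
N₈-false 1F = (0 , 5) ∷ (1 , 6) ∷ (2 , 5) ∷ (3 , 6) ∷ (4 , 7) ∷ []
N₈-false 2F = (0 , 5) ∷ (1 , 4) ∷ (2 , 7) ∷ (3 , 6) ∷ []
N₈-false 3F = (0 , 6) ∷ (1 , 5) ∷ (2 , 7) ∷ (3 , 6) ∷ (4 , 7) ∷ []
N₈-false 4F = (0 , 6) ∷ (1 , 4) ∷ (2 , 5) ∷ (3 , 7) ∷ []
N₈-false 5F = (0 , 6) ∷ (1 , 5) ∷ (2 , 7) ∷ (3 , 6) ∷ (4 , 7) ∷ []
N₈-false 6F = (0 , 5) ∷ (1 , 4) ∷ (2 , 7) ∷ (3 , 6) ∷ []

-- N₈ lists the 8-vertex triangle-free graphs with a marked vertex set, up to
-- isomorphism.  The edge lists come from an exhaustive computer search.  Since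
-- there are exactly seven such graphs, N₈-triangleFree, N₈-marked and
-- N₈-distinct below show that the list is the right one.
N₈ : Fin 7 → Graph (Fin 8)
N₈ i = fromEdges (N₈-true i ++ N₈-false i)

N₈-triangleFree : ∀ i → TriangleFree (N₈ i)
N₈-triangleFree = from-yes (Fin.all? λ i → Fin.all? λ u → Fin.all? λ v → Fin.all? λ w →
  ¬? (T? (adj (N₈ i) u v) ×-dec T? (adj (N₈ i) v w) ×-dec T? (adj (N₈ i) u w)))

-- S is the set of vertices joined to the additional vertex of the cone by an
-- edge of colour true.  A conflict is an edge u v of N₈ i that forms a
-- monochromatic triangle with that vertex.
Conflict : Fin 7 → Subset 8 → Fin 8 → Fin 8 → Set
Conflict i S u v = Adj (N₈ i) u v × lookup S u ≡ lookup S v ×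
                   lookup S u ≡ adj (fromEdges (N₈-true i)) u v

conflict? : ∀ i S → Dec (∃₂ (Conflict i S))
conflict? i S = Fin.any? λ u → Fin.any? λ v →
  T? (adj (N₈ i) u v) ×-dec (lookup S u Bool.≟ lookup S v) ×-dec
  (lookup S u Bool.≟ adj (fromEdges (N₈-true i)) u v)

conflictFree? : ∀ i → Dec (∃ λ S → ¬ ∃₂ (Conflict i S))
conflictFree? i = anySubset? λ S → ¬? (conflict? i S)

conflict : ∀ i S → ∃₂ (Conflict i S)
conflict i S = decidable-stable (conflict? i S) λ ¬p →
  from-yes (Fin.all? λ j → ¬? (conflictFree? j)) i (S , ¬p)

N₈-marked : ∀ i → Marked (N₈ i)
N₈-marked i = c , free , unextendable
  where
  R : Graph (Fin 8)
  R = fromEdges (N₈-true i)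

  c : Colouring (N₈ i)
  c = record { colour = λ u v _ → adj R u v ; colour-sym = λ u v _ _ → adj-sym R u v }

  free : Free c
  free (u , v , w , uv , vw , uw , _) = N₈-triangleFree i u v w (uv , vw , uw)

  unextendable : (c′ : Colouring (cone (N₈ i))) → Extends c′ c → ¬ Free c′
  unextendable c′ ext free′ =
    let S = tabulate λ w → colour c′ nothing (just w) _
        u , v , e , su≡sv , su≡c = conflict i S
        look = lookup∘tabulate λ w → colour c′ nothing (just w) _
    in free′
      ( nothing , just u , just v , _ , e , _
      , trans (sym (look u)) (trans su≡c (sym (ext u v e)))
      , trans (sym (look u)) (trans su≡sv (look v)))

-- The numbers of walks of length 3 tell the seven graphs apart.
walks : ∀ {n} → Graph (Fin n) → ℕ → Fin n → ℕ
walks G zero    u = 1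
walks G (suc k) u = sum λ v → if adj G u v then walks G k v else 0

walks-≅ : ∀ {m n} {G : Graph (Fin m)} {H : Graph (Fin n)} (f : G ≅ H) k u →
          walks G k u ≡ walks H k (Inverse.to (_≅_.bijection f) u)
walks-≅ f zero    u = refl
walks-≅ {G = G} {H} f (suc k) u = trans
  (sum-cong-≗ λ v → cong₂ (λ b x → if b then x else 0)
                          (_≅_.preserves f u v) (walks-≅ f k v))
  (sym (sum-permute (λ w → if adj H (Inverse.to π u) w then walks H k w else 0) π))
  where π = _≅_.bijection f

N₈-distinct : ∀ i j → N₈ i ≅ N₈ j → i ≡ j
N₈-distinct i j f = from-yes
  (Fin.all? λ i → Fin.all? λ j → (total i ℕ.≟ total j) →-dec (i ≟ j)) i j
  (trans (sum-cong-≗ (walks-≅ f 3)) (sym (sum-permute (walks (N₈ j) 3) (_≅_.bijection f))))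
  where
  total : Fin 7 → ℕ
  total i = sum (walks (N₈ i) 3)

{-# OPTIONS --safe #-}
module Submission where

-- If the neighbourhood of v can be split into two parts such that no edge of
-- colour b joins two vertices of part b, then a (3,3)-free colouring of G − v
-- extends to G.  So for minimal G the colouring of G − v does not split G(v).
-- A minimal unsplittable set U admits no autarky: whenever some vertices of U
-- are assigned to parts, an edge of the colour of one of them leads to a vertex
-- that is not assigned to the opposite part, as otherwise a splitting of the
-- unassigned vertices could be completed.  This rule drives an exhaustive search
-- for U, in which vertices are named in the order of their discovery, so that
-- few isomorphic configurations are met.  With at most 8 vertices and without
-- triangles, the only outcomes have 8 vertices and are copies of N₈ i.

open import Data.Nat using (ℕ; _≥_)
open import Data.Fin using (Fin)
open import Data.Product using (∃; _×_)
open import Relation.Binary.PropositionalEquality using (_≡_)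
open import Defs

open import Data.Bool using (Bool; true; false; T; if_then_else_; _∧_; _∨_; not)
open import Data.Bool.ListAction using (any; all)
open import Data.Bool.Properties using (T-∧; T-∨; T?; T-≡; T-irrelevant; ⇔→≡; not-¬)
import Data.Bool.Properties as Bool
open import Data.Empty using (⊥; ⊥-elim)
open import Data.Fin using (toℕ; zero; suc; _≟_)
open import Data.Fin.Patterns using (0F)
import Data.Fin.Properties as Fin
open import Data.Fin.Subset
  using (Subset; _∈_; ∣_∣; _-_; _⊆_; ∁; ⁅_⁆; _∪_; ⊤) renaming (⊥ to ∅)
open import Data.Fin.Subset.Properties
  using (_∈?_; anySubset?; nonempty?; p⊆q⇒∣p∣≤∣q∣; p⊂q⇒∣p∣<∣q∣; p─q⊆p;
         x∈p∧x≢y⇒x∈p-y; x∈p⇒∣p-x∣<∣p∣; x∈p∪q⁻; x∈p∪q⁺; x∈⁅x⁆; x∈⁅y⁆⇒x≡y;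
         x≢y⇒x∉⁅y⁆; x∉p⇒x∈∁p; x∈p⇒x∉∁p; ∉⊥; ∈⊤; ∣⊤∣≡n; ∣p∣≤n)
open import Data.List
  using (List; []; _∷_; _++_; map; mapMaybe; filterᵇ; concatMap; downFrom; upTo;
         length; null; allFin)
open import Data.List.Extrema.Nat using (v≤min⁺)
open import Data.List.Membership.Propositional using (lose; find) renaming (_∈_ to _∈ₗ_)
open import Data.List.Membership.Propositional.Properties
  using (∈-filter⁺; ∈-filter⁻; ∈-++⁺ˡ; ∈-++⁺ʳ; ∈-++⁻; ∈-concatMap⁺; ∈-concatMap⁻;
         ∈-downFrom⁺; ∈-downFrom⁻; ∈-map⁺; ∈-map⁻)
import Data.List.Relation.Unary.All as All
import Data.List.Relation.Unary.All.Properties as All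
open import Data.List.Relation.Unary.Any as Any using (Any; here; there)
open import Data.List.Relation.Unary.Any.Properties using (any⁺; any⁻)
open import Data.Maybe as Maybe using (Maybe; just; nothing; fromMaybe)
import Data.Maybe.Properties as Maybe
open import Data.Nat using (zero; suc; _+_; _≤_; _<_; z≤n; s≤s; _≡ᵇ_; _<ᵇ_)
import Data.Nat.Properties as ℕ
open import Data.Product using (∃₂; _,_; proj₁; proj₂)
open import Data.Sum using (_⊎_; inj₁; inj₂)
open import Data.Vec using (Vec; []; _∷_; tabulate; lookup)
open import Data.Vec.Properties using (lookup∘tabulate; []=⇒lookup; lookup⇒[]=)
open import Data.Vec.Properties.WithK using ([]=-irrelevant)
open import Function using (_∘_; Equivalence; case_of_; mk⇔; mk↔ₛ′)
open import Relation.Binary using (tri<; tri≈; tri>)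
open import Relation.Binary.PropositionalEquality
  using (_≢_; refl; sym; trans; cong; cong₂; subst; subst₂)
open import Relation.Nullary using (¬_; Dec; yes; no; contradiction)
open import Relation.Nullary.Decidable
  using (¬?; _×-dec_; _⊎-dec_; _→-dec_; map′; decidable-stable)

-- The search procedure

_[_≔_] : {A : Set} → (ℕ → A) → ℕ → A → ℕ → A
(f [ k ≔ x ]) i = if i ≡ᵇ k then x else f i

_==_ : Bool → Bool → Bool
true  == c = c
false == c = not c

-- Vertices are numbered in the order of their discovery.  In edge i j c, c is the
-- colour and always j < i.
data Edge : Set where
  edge : ℕ → ℕ → Bool → Edge

-- The pair (p , s) puts the vertex p into part s.
Assignment : Set
Assignment = List (ℕ × Bool)

value : Assignment → ℕ → Maybe Bool
value []            p = nothing
value ((q , s) ∷ A) p = if p ≡ᵇ q then just s else value A p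

is : Bool → Maybe Bool → Bool
is b (just c) = b == c
is b nothing  = false

clash : Bool → Maybe Bool → Maybe Bool → Bool
clash c x y = is c x ∧ not (is (not c) y)

-- One end is in the part given by the colour, and the other one is not (yet) in
-- the opposite part.
relevant : Assignment → Edge → Bool
relevant A (edge i j c) = between (value A i) (value A j)
  where
  between : Maybe Bool → Maybe Bool → Bool
  between x y = clash c x y ∨ clash c y x

-- Unit propagation: an edge whose colour is the part of one end forces its other end into the
-- opposite part.
implied : ℕ × Bool → Edge → Maybe (ℕ × Bool)
implied (p , s) (edge i j c) =
  if s == c
  then (if p ≡ᵇ i then just (j , not s) else
        if p ≡ᵇ j then just (i , not s) else nothing)
  else nothing

-- Nothing is proved about close and select: step checks what its soundness needs.
close : ℕ → List Edge → Assignment → Assignment → Maybe Assignment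
close zero    es todo             A = nothing
close (suc m) es []               A = just A
close (suc m) es ((p , s) ∷ todo) A with value A p
... | nothing = close m es (mapMaybe (implied (p , s)) es ++ todo) ((p , s) ∷ A)
... | just t  = if s == t then close m es todo A else nothing

-- Weights are evaluated lazily, so stopping early at a small weight saves time.
cheapest : Assignment × ℕ → List (Assignment × ℕ) → Assignment
cheapest (A , m) xs = if m <ᵇ 2 then A else continue xs
  where
  continue : List (Assignment × ℕ) → Assignment
  continue []             = A
  continue ((B , n) ∷ xs) = cheapest (if n <ᵇ m then (B , n) else (A , m)) xs

select : ℕ → List Edge → List Edge → Maybe Assignment
select k es os = choose (mapMaybe weigh (concatMap literals (downFrom k)))
  where
  literals : ℕ → Assignment
  literals p = (p , false) ∷ (p , true) ∷ []

  -- The weight is the number of branches in step.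
  weigh : ℕ × Bool → Maybe (Assignment × ℕ)
  -- 50 is fuel for the propagation. A contradiction and exhausted fuel both give `nothing`, and the
  -- literal is dropped.
  weigh l with close 50 es (l ∷ []) []
  ... | nothing = nothing
  ... | just A  = just (A , length (filterᵇ (relevant A) os) +
                            (if k <ᵇ 8 then length A else 0))

  choose : List (Assignment × ℕ) → Maybe Assignment
  choose []       = nothing
  choose (x ∷ xs) = just (cheapest x xs)

joins : ℕ → ℕ → Edge → Bool
joins p q (edge i j _) = (p ≡ᵇ i) ∧ (q ≡ᵇ j) ∨ (p ≡ᵇ j) ∧ (q ≡ᵇ i)

adjacent : List Edge → ℕ → ℕ → Bool
adjacent es p q = any (joins p q) es

-- The second edge has the same ends as the first one or forms a triangle with it
-- and an edge of es.
blocks : List Edge → Edge → Edge → Bool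
blocks es (edge p q _) (edge i j _) =
  (i ≡ᵇ p) ∧ ((j ≡ᵇ q) ∨ adjacent es q j) ∨
  (i ≡ᵇ q) ∧ adjacent es p j ∨
  (j ≡ᵇ p) ∧ adjacent es q i ∨
  (j ≡ᵇ q) ∧ adjacent es p i

prune : List Edge → Edge → List Edge → List Edge
prune es e = filterᵇ (not ∘ blocks es e)

sameEdge : Edge → Edge → Bool
sameEdge (edge p q c) (edge i j d) = (p ≡ᵇ i) ∧ (q ≡ᵇ j) ∧ (c == d)

remove : Edge → List Edge → List Edge
remove e = filterᵇ (not ∘ sameEdge e)

fresh : ℕ → List Edge
fresh k = concatMap (λ j → edge k j true ∷ edge k j false ∷ []) (downFrom k)

-- One fixed colour turns coloured graphs into plain ones, so that `complete` runs through graphs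
-- instead of colourings.
uncolour : Edge → Edge
uncolour (edge i j _) = edge i j true

-- The cases are distinguished by the first edge of the list that is present: the edges before it
-- are removed from `os`. The case that none is present is left to `attach`.
branches : (List Edge → List Edge → Bool) → List Edge → List Edge → List Edge → Bool
branches go es []      os = true
branches go es (e ∷ o) os = go (e ∷ es) (prune es e os) ∧ branches go es o (remove e os)

module Search (accept : List Edge → Bool) where

  -- Decides the open edges one by one; a leaf, where none is open, is a whole graph and goes to
  -- `accept`.
  complete : ℕ → List Edge → List Edge → Bool
  complete zero    es os         = false
  complete (suc m) es []         = accept es
  complete (suc m) es os@(e ∷ _) =
    complete m (e ∷ es) (prune es e os) ∧ complete m es (remove e os)

  -- The far end of an exposed edge is a vertex without a name; it gets the name k, and the edge has
  -- the colour of the part of p.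
  attach : (ℕ → List Edge → List Edge → Bool) →
           ℕ → List Edge → List Edge → ℕ × Bool → Bool
  attach go k es os (p , s) =
    go (suc k) (edge k p s ∷ es) (prune es (edge k p s) (fresh k ++ os))

  -- Here es are the known edges between the vertices below k, and all others are
  -- among os.  Colours no longer matter once every choice of a part for a single
  -- vertex is contradictory.  There are 56 possible coloured edges on 8 vertices.
  step : (ℕ → List Edge → List Edge → Bool) →
         ℕ → List Edge → List Edge → Maybe Assignment → Bool
  -- `nothing` with fewer than 8 named vertices makes the whole search fail, so its success shows
  -- that 8 vertices are necessary.
  step go k es os nothing  =
    (k ≡ᵇ 8) ∧ complete 57 (map uncolour es) (map uncolour os)
  step go k es os (just A) =
    -- A non-empty `A` provides the assigned vertex for `exposedEdge`. As no known edge is relevant,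
    -- the exposed edge is undecided or leads to a new vertex.
    not (null A) ∧ all (λ l → proj₁ l <ᵇ k) A ∧ not (any (relevant A) es) ∧
    branches (go k) es (filterᵇ (relevant A) os) os ∧
    ((k ≡ᵇ 8) ∨ all (attach go k es (filterᵇ (not ∘ relevant A) os)) A)

  search : ℕ → ℕ → List Edge → List Edge → Bool
  search zero    k es os = false
  search (suc m) k es os = step (search m) k es os (select k es os)

-- Numberings of vertices

update-new : ∀ {A : Set} (f : ℕ → A) k x → (f [ k ≔ x ]) k ≡ x
update-new f k x with k ≡ᵇ k in eq
... | true  = refl
... | false = ⊥-elim (subst T eq (ℕ.≡⇒≡ᵇ k k refl))

update-old : ∀ {A : Set} (f : ℕ → A) {k} x {i} → i < k → (f [ k ≔ x ]) i ≡ f i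
update-old f {k} x {i} i<k with i ≡ᵇ k in eq
... | false = refl
... | true  = contradiction (ℕ.≡ᵇ⇒≡ i k (subst T (sym eq) _)) (ℕ.<⇒≢ i<k)

==-sound : ∀ {b c} → T (b == c) → b ≡ c
==-sound {true}  {true}  _ = refl
==-sound {false} {false} _ = refl

==-refl : ∀ b → T (b == b)
==-refl true  = _
==-refl false = _

is-sound : ∀ {b m} → T (is b m) → m ≡ just b
is-sound {m = just c} t = cong just (sym (==-sound t))

∣S∣-lower-bound : ∀ {n} k (S : Subset n) (h : Fin k → Fin n) →
                  (∀ {a b} → h a ≡ h b → a ≡ b) → (∀ a → h a ∈ S) → k ≤ ∣ S ∣
∣S∣-lower-bound zero    S h inj h∈S = z≤n
∣S∣-lower-bound (suc k) S h inj h∈S = ℕ.≤-trans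
  (s≤s (∣S∣-lower-bound k (S - h zero) (h ∘ suc) (Fin.suc-injective ∘ inj) λ a →
    x∈p∧x≢y⇒x∈p-y (h∈S (suc a)) λ eq → case inj eq of λ ()))
  (x∈p⇒∣p-x∣<∣p∣ (h∈S zero))

-- Pigeonhole principle: a missed element of S would extend h to k + 1 distinct elements of S.
injective⇒surjective : ∀ {n k} {S : Subset n} (h : Fin k → Fin n) →
  (∀ {a b} → h a ≡ h b → a ≡ b) → (∀ a → h a ∈ S) → ∣ S ∣ ≤ k →
  ∀ {x} → x ∈ S → ∃ λ a → h a ≡ x
injective⇒surjective {n} {k} {S} h inj h∈S ∣S∣≤k {x} x∈S with Fin.any? (λ a → h a ≟ x)
... | yes hit = hit
... | no miss = contradiction (ℕ.≤-trans (∣S∣-lower-bound (suc k) S h′ inj′ h′∈S) ∣S∣≤k) ℕ.1+n≰n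
  where
  h′ : Fin (suc k) → Fin n
  h′ zero    = x
  h′ (suc a) = h a

  inj′ : ∀ {a b} → h′ a ≡ h′ b → a ≡ b
  inj′ {zero}  {zero}  _  = refl
  inj′ {zero}  {suc b} eq = contradiction (b , sym eq) miss
  inj′ {suc a} {zero}  eq = contradiction (a , eq) miss
  inj′ {suc a} {suc b} eq = cong suc (inj eq)

  h′∈S : ∀ a → h′ a ∈ S
  h′∈S zero    = x∈S
  h′∈S (suc a) = h∈S a

record Names {n} (S : Subset n) (k : ℕ) (f : ℕ → Fin n) : Set where
  field
    injective : ∀ {i j} → i < k → j < k → f i ≡ f j → i ≡ j
    member    : ∀ {i} → i < k → f i ∈ S

  toFin-injective : ∀ {a b : Fin k} → f (toℕ a) ≡ f (toℕ b) → a ≡ b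
  toFin-injective {a} {b} = Fin.toℕ-injective ∘ injective (Fin.toℕ<n a) (Fin.toℕ<n b)

  k≤∣S∣ : k ≤ ∣ S ∣
  k≤∣S∣ = ∣S∣-lower-bound k S (f ∘ toℕ) toFin-injective (λ a → member (Fin.toℕ<n a))

addName : ∀ {n} {S : Subset n} {k f x} → Names S k f → x ∈ S →
          (∀ {i} → i < k → f i ≢ x) → Names S (suc k) (f [ k ≔ x ])
addName {S = S} {k} {f} {x} N x∈S new = record { injective = inj ; member = mem }
  where
  open Names N

  mem : ∀ {i} → i < suc k → (f [ k ≔ x ]) i ∈ S
  mem i<1+k with ℕ.m<1+n⇒m<n∨m≡n i<1+k
  ... | inj₁ i<k  = subst (_∈ S) (sym (update-old f x i<k)) (member i<k)
  ... | inj₂ refl = subst (_∈ S) (sym (update-new f k x)) x∈S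

  inj : ∀ {i j} → i < suc k → j < suc k → (f [ k ≔ x ]) i ≡ (f [ k ≔ x ]) j → i ≡ j
  inj i<1+k j<1+k eq with ℕ.m<1+n⇒m<n∨m≡n i<1+k | ℕ.m<1+n⇒m<n∨m≡n j<1+k
  ... | inj₁ i<k  | inj₁ j<k  =
    injective i<k j<k (trans (sym (update-old f x i<k)) (trans eq (update-old f x j<k)))
  ... | inj₁ i<k  | inj₂ refl =
    contradiction (trans (sym (update-old f x i<k)) (trans eq (update-new f k x))) (new i<k)
  ... | inj₂ refl | inj₁ j<k  =
    contradiction (trans (sym (update-old f x j<k)) (trans (sym eq) (update-new f k x))) (new j<k)
  ... | inj₂ refl | inj₂ refl = refl

-- Splittings

module Coloured {n} (col : Fin n → Fin n → Maybe Bool) (col-sym : ∀ u w → col u w ≡ col w u)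
  where

  -- If x colours the edges from a further vertex to U, this says that no monochromatic triangle
  -- contains that vertex. The colour `nothing` stands for a non-edge.
  Splits : (Fin n → Bool) → Subset n → Set
  Splits x U = ∀ u w → u ∈ U → w ∈ U → col u w ≡ just (x u) → x u ≢ x w

  Splittable : Subset n → Set
  Splittable U = ∃ λ x → Splits x U

  infix 4 _≟ᶜ_
  _≟ᶜ_ : (m m′ : Maybe Bool) → Dec (m ≡ m′)
  _≟ᶜ_ = Maybe.≡-dec Bool._≟_

  splittable? : ∀ U → Dec (Splittable U)
  splittable? U with anySubset? (λ S → ¬? (bad? S))
    where
    bad? : ∀ S → Dec (∃₂ λ u w →
      u ∈ U × w ∈ U × col u w ≡ just (lookup S u) × lookup S u ≡ lookup S w)
    bad? S = Fin.any? λ u → Fin.any? λ w → (u ∈? U) ×-dec (w ∈? U) ×-dec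
             (col u w ≟ᶜ just (lookup S u)) ×-dec (lookup S u Bool.≟ lookup S w)
  ... | yes (S , good) =
    yes (lookup S , λ u w u∈ w∈ c≡ x≡ → good (u , w , u∈ , w∈ , c≡ , x≡))
  ... | no all-bad = no λ { (x , split) → all-bad (tabulate x ,
    λ { (u , w , u∈ , w∈ , c≡ , x≡) →
        split u w u∈ w∈ (trans c≡ (cong just (lookup∘tabulate x u)))
          (trans (sym (lookup∘tabulate x u)) (trans x≡ (lookup∘tabulate x w))) }) }

  record Critical (U : Subset n) : Set where
    field
      unsplittable : ¬ Splittable U
      deletion     : ∀ {u} → u ∈ U → Splittable (U - u)

  -- Vertices are deleted as long as the set stays unsplittable; this stops because m bounds the
  -- size.
  criticalSubset : ∀ m U → ∣ U ∣ ≤ m → ¬ Splittable U → ∃ λ W → W ⊆ U × Critical W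
  criticalSubset m U ∣U∣≤m unsplit
    with Fin.any? (λ u → (u ∈? U) ×-dec ¬? (splittable? (U - u)))
  ... | no none = U , (λ z → z) , record
    { unsplittable = unsplit
    ; deletion     = λ {u} u∈U →
        decidable-stable (splittable? (U - u)) λ un → none (u , u∈U , un) }
  criticalSubset zero U ∣U∣≤m unsplit | yes (u , u∈U , un) =
    contradiction (ℕ.≤-trans (x∈p⇒∣p-x∣<∣p∣ u∈U) ∣U∣≤m) λ ()
  criticalSubset (suc m) U ∣U∣≤m unsplit | yes (u , u∈U , un)
    with criticalSubset m (U - u) (ℕ.≤-pred (ℕ.≤-trans (x∈p⇒∣p-x∣<∣p∣ u∈U) ∣U∣≤m)) un
  ... | W , W⊆ , crit = W , (λ w∈ → p─q⊆p U _ (W⊆ w∈)) , crit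

  Exposed : Subset n → (Fin n → Maybe Bool) → Fin n → Fin n → Bool → Set
  Exposed U val u w s =
    u ∈ U × w ∈ U × val u ≡ just s × col u w ≡ just s × val w ≢ just (not s)

  -- A critical set has no autarky: otherwise val combines with a splitting of U - v.
  exposedEdge : ∀ {U} → Critical U → (val : Fin n → Maybe Bool) →
                ∀ {v t} → v ∈ U → val v ≡ just t → ∃ λ u → ∃₂ (Exposed U val u)
  exposedEdge {U} crit val {v} {t} v∈U val-v
    with Fin.any? (λ u → Fin.any? λ w → try u w true ⊎-dec try u w false)
    where
    try : ∀ u w s → Dec (Exposed U val u w s)
    try u w s = (u ∈? U) ×-dec (w ∈? U) ×-dec (val u ≟ᶜ just s) ×-dec
                (col u w ≟ᶜ just s) ×-dec ¬? (val w ≟ᶜ just (not s))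
  ... | yes (u , w , inj₁ e) = u , w , true , e
  ... | yes (u , w , inj₂ e) = u , w , false , e
  ... | no none = contradiction (x , split) unsplittable
    where
    open Critical crit

    y : Fin n → Bool
    y = proj₁ (deletion v∈U)

    x : Fin n → Bool
    x u = fromMaybe (y u) (val u)

    either : ∀ {u w} s → Exposed U val u w s →
             Exposed U val u w true ⊎ Exposed U val u w false
    either true  = inj₁
    either false = inj₂

    closed : ∀ {u w s} → u ∈ U → w ∈ U → val u ≡ just s → col u w ≡ just s →
             val w ≡ just (not s)
    closed {u} {w} {s} u∈ w∈ eu c≡ = decidable-stable (val w ≟ᶜ just (not s)) λ ew →
      none (u , w , either s (u∈ , w∈ , eu , c≡ , ew))

    -- The vertex v is assigned, so all unassigned vertices of U lie in `U - v`, which y splits.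
    remaining : ∀ {u} → u ∈ U → val u ≡ nothing → u ∈ U - v
    remaining u∈U eq = x∈p∧x≢y⇒x∈p-y u∈U λ { refl → case trans (sym eq) val-v of λ () }

    split : Splits x U
    split u w u∈ w∈ c≡ x≡ with val u in eu | val w in ew
    ... | just s | m with closed u∈ w∈ eu c≡
    ...   | e with trans (sym ew) e
    ...     | refl = not-¬ refl x≡
    -- Equal parts make t the colour of the edge, so w would force a value on the unassigned u.
    split u w u∈ w∈ c≡ x≡ | nothing | just t
      with trans (sym eu) (closed w∈ u∈ ew (trans (col-sym w u) (trans c≡ (cong just x≡))))
    ... | ()
    split u w u∈ w∈ c≡ x≡ | nothing | nothing =
      proj₂ (deletion v∈U) u w (remaining u∈ eu) (remaining w∈ ew) c≡ x≡

-- Soundness of the search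

∧⁻ : ∀ {x y} → T (x ∧ y) → T x × T y
∧⁻ = Equivalence.to T-∧

∨⁻ : ∀ {x y} → T (x ∨ y) → T x ⊎ T y
∨⁻ = Equivalence.to T-∨

≡⇒T : ∀ {b} → b ≡ true → T b
≡⇒T = Equivalence.from T-≡

not⁻ : ∀ {b} → T (not b) → ¬ T b
not⁻ {false} _ ()

not⁺ : ∀ {b} → ¬ T b → T (not b)
not⁺ {false} _ = _
not⁺ {true}  h = h _

∈-filterᵇ⁺ : ∀ {A : Set} (p : A → Bool) {x xs} → x ∈ₗ xs → T (p x) → x ∈ₗ filterᵇ p xs
∈-filterᵇ⁺ p = ∈-filter⁺ (T? ∘ p)

∈-filterᵇ⁻ : ∀ {A : Set} (p : A → Bool) {x xs} →
             x ∈ₗ filterᵇ p xs → x ∈ₗ xs × T (p x)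
∈-filterᵇ⁻ p = ∈-filter⁻ (T? ∘ p)

record TriangleFreeOn {n} (U : Subset n) (col : Fin n → Fin n → Maybe Bool) : Set where
  field
    col-sym  : ∀ u w → col u w ≡ col w u
    triangle : ∀ {u v w a b c} → u ∈ U → v ∈ U → w ∈ U →
               col u v ≡ just a → col v w ≡ just b → col u w ≡ just c → ⊥

module Naming {n} (U : Subset n) (col : Fin n → Fin n → Maybe Bool)
              (TF : TriangleFreeOn U col) where
  open TriangleFreeOn TF

  -- The invariant that links a state of the search to the actual coloured graph. Entries of `os`
  -- may fail to be edges, but no edge between named vertices is lost.
  record Valid (k : ℕ) (es os : List Edge) (f : ℕ → Fin n) : Set where
    field
      names    : Names U k f
      es-real  : ∀ {i j c} → edge i j c ∈ₗ es → j < i × i < k × col (f i) (f j) ≡ just c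
      os-range : ∀ {i j c} → edge i j c ∈ₗ os → j < i × i < k
      total    : ∀ {i j c} → j < i → i < k → col (f i) (f j) ≡ just c →
                 edge i j c ∈ₗ es ⊎ edge i j c ∈ₗ os
    open Names names public

  Real : (ℕ → Fin n) → Edge → Set
  Real f (edge i j c) = col (f i) (f j) ≡ just c

  real? : ∀ f e → Dec (Real f e)
  real? f (edge i j c) = Maybe.≡-dec Bool._≟_ (col (f i) (f j)) (just c)

  private variable
    k : ℕ
    es os : List Edge
    f : ℕ → Fin n

  swap : ∀ {u w c} → col u w ≡ just c → col w u ≡ just c
  swap {u} {w} = trans (col-sym w u)

  adjacent-sound : Valid k es os f → ∀ {p q} → T (adjacent es p q) →
                   ∃ λ c → col (f p) (f q) ≡ just c
  adjacent-sound {es = es} V {p} {q} t with find (any⁻ (joins p q) es t)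
  ... | edge i j c , e∈ , t′ with ∨⁻ {(p ≡ᵇ i) ∧ (q ≡ᵇ j)} t′
  ...   | inj₁ t″ with ∧⁻ {p ≡ᵇ i} t″
  ...     | a , b with ℕ.≡ᵇ⇒≡ p i a | ℕ.≡ᵇ⇒≡ q j b
  ...       | refl | refl = c , proj₂ (proj₂ (Valid.es-real V e∈))
  adjacent-sound V {p} {q} t | edge i j c , e∈ , t′ | inj₂ t″ with ∧⁻ {p ≡ᵇ j} t″
  ...     | a , b with ℕ.≡ᵇ⇒≡ p j a | ℕ.≡ᵇ⇒≡ q i b
  ...       | refl | refl = c , swap (proj₂ (proj₂ (Valid.es-real V e∈)))

  adjacent-complete : ∀ {i j c} → edge i j c ∈ₗ es → T (adjacent es i j)
  adjacent-complete {i = i} {j} e∈ = any⁺ (joins i j) (lose e∈ (Equivalence.from T-∨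
    (inj₁ (Equivalence.from T-∧ (ℕ.≡⇒≡ᵇ i i refl , ℕ.≡⇒≡ᵇ j j refl)))))

  -- Two actual edges cannot form a triangle with a known one, so the only remaining reason for
  -- blocking is that they have the same ends.
  blocks-sound : ∀ {p q c i j d} → Valid k es os f →
    q < p → p < k → j < i → i < k → Real f (edge p q c) → Real f (edge i j d) →
    T (blocks es (edge p q c) (edge i j d)) → i ≡ p × j ≡ q
  blocks-sound {k} {es} {os} {f} {p} {q} {c} {i} {j} {d} V q<p p<k j<i i<k pq ij t =
    case ∨⁻ {(i ≡ᵇ p) ∧ ((j ≡ᵇ q) ∨ adjacent es q j)} t of λ
      { (inj₁ t₁) → case₁ (∧⁻ {i ≡ᵇ p} t₁)
      ; (inj₂ t₁) → ⊥-elim (case ∨⁻ {(i ≡ᵇ q) ∧ adjacent es p j} t₁ of λ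
        { (inj₁ t₂) → case₂ (∧⁻ {i ≡ᵇ q} t₂)
        ; (inj₂ t₂) → case ∨⁻ {(j ≡ᵇ p) ∧ adjacent es q i} t₂ of λ
          { (inj₁ t₃) → case₃ (∧⁻ {j ≡ᵇ p} t₃)
          ; (inj₂ t₃) → case₄ (∧⁻ {j ≡ᵇ q} t₃) } }) }
    where
    open Valid V

    p∈ : f p ∈ U
    p∈ = member p<k
    q∈ : f q ∈ U
    q∈ = member (ℕ.<-trans q<p p<k)
    i∈ : f i ∈ U
    i∈ = member i<k
    j∈ : f j ∈ U
    j∈ = member (ℕ.<-trans j<i i<k)

    link : ∀ {a b} → T (adjacent es a b) → ∃ λ c → col (f a) (f b) ≡ just c
    link = adjacent-sound V

    case₁ : T (i ≡ᵇ p) × T ((j ≡ᵇ q) ∨ adjacent es q j) → i ≡ p × j ≡ q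
    case₁ (a , b) with ℕ.≡ᵇ⇒≡ i p a | ∨⁻ {j ≡ᵇ q} b
    ... | refl | inj₁ j≡q = refl , ℕ.≡ᵇ⇒≡ j q j≡q
    ... | refl | inj₂ adj = ⊥-elim (triangle p∈ q∈ j∈ pq (proj₂ (link adj)) ij)

    case₂ : T (i ≡ᵇ q) × T (adjacent es p j) → ⊥
    case₂ (a , b) with ℕ.≡ᵇ⇒≡ i q a
    ... | refl = triangle p∈ i∈ j∈ pq ij (proj₂ (link b))

    case₃ : T (j ≡ᵇ p) × T (adjacent es q i) → ⊥
    case₃ (a , b) with ℕ.≡ᵇ⇒≡ j p a
    ... | refl = triangle i∈ p∈ q∈ ij pq (swap (proj₂ (link b)))

    case₄ : T (j ≡ᵇ q) × T (adjacent es p i) → ⊥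
    case₄ (a , b) with ℕ.≡ᵇ⇒≡ j q a
    ... | refl = triangle i∈ q∈ p∈ ij (swap pq) (swap (proj₂ (link b)))

  sameEdge-sound : ∀ e g → T (sameEdge e g) → e ≡ g
  sameEdge-sound (edge p q c) (edge i j d) t with ∧⁻ {p ≡ᵇ i} t
  ... | a , t′ with ∧⁻ {q ≡ᵇ j} t′
  ...   | b , t″ with ℕ.≡ᵇ⇒≡ p i a | ℕ.≡ᵇ⇒≡ q j b | ==-sound {c} {d} t″
  ...     | refl | refl | refl = refl

  addEdge : ∀ {p q c} → Valid k es os f → q < p → p < k → Real f (edge p q c) →
            Valid k (edge p q c ∷ es) (prune es (edge p q c) os) f
  addEdge {k} {es} {os} {f} {p} {q} {c} V q<p p<k pq = record
    { names    = names
    ; es-real  = λ { (here refl) → q<p , p<k , pq ; (there e∈) → es-real e∈ }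
    ; os-range = os-range ∘ proj₁ ∘ ∈-filterᵇ⁻ (not ∘ blocks es (edge p q c))
    ; total    = total′
    }
    where
    open Valid V

    total′ : ∀ {i j d} → j < i → i < k → Real f (edge i j d) →
             edge i j d ∈ₗ edge p q c ∷ es ⊎ edge i j d ∈ₗ prune es (edge p q c) os
    total′ {i} {j} {d} j<i i<k ij with total j<i i<k ij
    ... | inj₁ e∈ = inj₁ (there e∈)
    ... | inj₂ e∈ with T? (blocks es (edge p q c) (edge i j d))
    ...   | no ¬b = inj₂ (∈-filterᵇ⁺ (not ∘ blocks es (edge p q c)) e∈ (not⁺ ¬b))
    -- A blocked actual edge has the ends p and q, and `col` gives it the colour c: it is the edge
    -- just added.
    ...   | yes b with blocks-sound V q<p p<k j<i i<k pq ij b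
    ...     | refl , refl with trans (sym ij) pq
    ...       | refl = inj₁ (here refl)

  discard : ∀ (P : Edge → Bool) → Valid k es os f → (∀ e → e ∈ₗ os → Real f e → T (P e)) →
            Valid k es (filterᵇ P os) f
  discard {k} {es} {os} {f} P V keep = record
    { names    = names
    ; es-real  = es-real
    ; os-range = os-range ∘ proj₁ ∘ ∈-filterᵇ⁻ P
    ; total    = λ j<i i<k ij → case total j<i i<k ij of λ
        { (inj₁ e∈) → inj₁ e∈
        ; (inj₂ e∈) → inj₂ (∈-filterᵇ⁺ P e∈ (keep _ e∈ ij)) }
    }
    where open Valid V

  removeEdge : ∀ {e} → Valid k es os f → ¬ Real f e → Valid k es (remove e os) f
  removeEdge {f = f} {e} V ¬e = discard (not ∘ sameEdge e) V λ g _ real-g →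
    not⁺ λ t → ¬e (subst (Real f) (sym (sameEdge-sound e g t)) real-g)

  ∈-fresh⁺ : ∀ {j} c → j < k → edge k j c ∈ₗ fresh k
  ∈-fresh⁺ {k} {j} c j<k = ∈-concatMap⁺ (λ j → edge k j true ∷ edge k j false ∷ [])
    (lose (∈-downFrom⁺ j<k) (either c))
    where
    either : ∀ c → edge k j c ∈ₗ (edge k j true ∷ edge k j false ∷ [])
    either true  = here refl
    either false = there (here refl)

  ∈-fresh⁻ : ∀ {i j c} → edge i j c ∈ₗ fresh k → i ≡ k × j < k
  ∈-fresh⁻ {k} e∈
    with find (∈-concatMap⁻ (λ j → edge k j true ∷ edge k j false ∷ []) {xs = downFrom k} e∈)
  ... | j , j∈ , here refl         = refl , ∈-downFrom⁻ j∈
  ... | j , j∈ , there (here refl) = refl , ∈-downFrom⁻ j∈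

  addVertex : ∀ {w} → Valid k es os f → w ∈ U → (∀ {i} → i < k → f i ≢ w) →
              Valid (suc k) es (fresh k ++ os) (f [ k ≔ w ])
  addVertex {k} {es} {os} {f} {w} V w∈U new = record
    { names    = addName names w∈U new
    ; es-real  = λ e∈ → let j<i , i<k , ij = es-real e∈ in
        j<i , ℕ.m<n⇒m<1+n i<k , trans (old j<i i<k) ij
    ; os-range = λ e∈ → case ∈-++⁻ (fresh k) e∈ of λ
        { (inj₁ e∈) → case ∈-fresh⁻ {k} e∈ of λ { (refl , j<k) → j<k , ℕ.n<1+n k }
        ; (inj₂ e∈) → let j<i , i<k = os-range e∈ in j<i , ℕ.m<n⇒m<1+n i<k }
    ; total    = total′
    }
    where
    open Valid V

    old : ∀ {i j} → j < i → i < k →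
          col ((f [ k ≔ w ]) i) ((f [ k ≔ w ]) j) ≡ col (f i) (f j)
    old j<i i<k = cong₂ col (update-old f w i<k) (update-old f w (ℕ.<-trans j<i i<k))

    total′ : ∀ {i j c} → j < i → i < suc k → Real (f [ k ≔ w ]) (edge i j c) →
             edge i j c ∈ₗ es ⊎ edge i j c ∈ₗ fresh k ++ os
    total′ {c = c} j<i i<1+k ij with ℕ.m<1+n⇒m<n∨m≡n i<1+k
    ... | inj₂ refl = inj₂ (∈-++⁺ˡ (∈-fresh⁺ c j<i))
    ... | inj₁ i<k with total j<i i<k (trans (sym (old j<i i<k)) ij)
    ...   | inj₁ e∈ = inj₁ e∈
    ...   | inj₂ e∈ = inj₂ (∈-++⁺ʳ (fresh k) e∈)

  module _ (accept : List Edge → Bool) where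
    open Search accept

    -- As no edge is open, `es` describes exactly the edges between the 8 names.
    Accepted : Set
    Accepted = ∃₂ λ es f → Valid 8 es [] f × T (accept es)

    complete-sound : ∀ m {es os f} → T (complete m es os) → Valid 8 es os f → Accepted
    complete-sound (suc m) {es} {[]} {f} t V = es , f , V , t
    complete-sound (suc m) {es} {os@(e@(edge p q c) ∷ _)} {f} t V
      with ∧⁻ {complete m (e ∷ es) (prune es e os)} t | real? f e
    ... | _  , t₂ | no ¬pq = complete-sound m t₂ (removeEdge V ¬pq)
    ... | t₁ , _  | yes pq with Valid.os-range V (here refl)
    ...   | q<p , p<8 = complete-sound m t₁ (addEdge V q<p p<8 pq)

-- Descends to the first entry of `o` that is an actual edge; the entries before it may be removed
-- from `os`.
branches-sound : ∀ {n} {U : Subset n} {col} (TF : TriangleFreeOn U col) → let open Naming U col TF in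
  ∀ {Goal : Set} {k f} (go : List Edge → List Edge → Bool) →
  (∀ {es os} → T (go es os) → Valid k es os f → Goal) →
  ∀ {es} o {os} → T (branches go es o os) → Valid k es os f →
  (∀ {i j c} → edge i j c ∈ₗ o → j < i × i < k) → Any (Real f) o → Goal
branches-sound {U = U} {col} TF {f = f} go go-sound {es} (e@(edge _ _ _) ∷ o) {os} t V range real
  with ∧⁻ {go (e ∷ es) (prune es e os)} t | Naming.real? U col TF f e | real
... | t₁ , _ | yes r | _ = let q<p , p<k = range (here refl) in
      go-sound t₁ (Naming.addEdge U col TF V q<p p<k r)
... | _ | no ¬r | here r = contradiction r ¬r
... | _ , t₂ | no ¬r | there rs =
      branches-sound TF go go-sound o t₂ (Naming.removeEdge U col TF V ¬r) (range ∘ there) rs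

uncoloured : ∀ {n} → (Fin n → Fin n → Maybe Bool) → Fin n → Fin n → Maybe Bool
uncoloured col u w = Maybe.map (λ _ → true) (col u w)

uncoloured⁻ : ∀ {m : Maybe Bool} {c} → Maybe.map (λ _ → true) m ≡ just c →
              c ≡ true × ∃ λ d → m ≡ just d
uncoloured⁻ {just d} refl = refl , d , refl

uncoloured-triangleFree : ∀ {n} {U : Subset n} {col} →
                          TriangleFreeOn U col → TriangleFreeOn U (uncoloured col)
uncoloured-triangleFree TF = record
  { col-sym  = λ u w → cong (Maybe.map _) (col-sym u w)
  ; triangle = λ u∈ v∈ w∈ uv vw uw → triangle u∈ v∈ w∈
      (proj₂ (proj₂ (uncoloured⁻ uv))) (proj₂ (proj₂ (uncoloured⁻ vw)))
      (proj₂ (proj₂ (uncoloured⁻ uw)))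
  }
  where open TriangleFreeOn TF

value-here : ∀ p s A → value ((p , s) ∷ A) p ≡ just s
value-here p s A with p ≡ᵇ p in eq
... | true  = refl
... | false = ⊥-elim (subst T eq (ℕ.≡⇒≡ᵇ p p refl))

value-∈ : ∀ A {p s} → value A p ≡ just s → (p , s) ∈ₗ A
value-∈ ((q , t) ∷ A) {p} eq with p ≡ᵇ q in p≡q
... | false = there (value-∈ A eq)
... | true with eq | ℕ.≡ᵇ⇒≡ p q (≡⇒T p≡q)
...   | refl | refl = here refl

clash⁺ : ∀ {c x y} → x ≡ just c → y ≢ just (not c) → T (clash c x y)
clash⁺ {c} refl y≢ = Equivalence.from T-∧ (==-refl c , not⁺ (y≢ ∘ is-sound))

module SearchSound {n} {U : Subset n} {col} (TF : TriangleFreeOn U col)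
  (crit : Coloured.Critical col (TriangleFreeOn.col-sym TF) U) (∣U∣≤8 : ∣ U ∣ ≤ 8)
  (accept : List Edge → Bool) where

  open TriangleFreeOn TF
  open Coloured col col-sym using (Exposed; exposedEdge)
  open Naming U col TF
  module Uncoloured = Naming U (uncoloured col) (uncoloured-triangleFree TF)
  open Search accept

  forget : ∀ {k es os f} → Valid k es os f →
           Uncoloured.Valid k (map uncolour es) (map uncolour os) f
  forget {k} {es} {os} {f} V = record
    { names    = names
    ; es-real  = λ e∈ → case ∈-map⁻ uncolour e∈ of λ
        { (edge _ _ _ , e∈ , refl) →
          let j<i , i<k , r = es-real e∈ in j<i , i<k , cong (Maybe.map _) r }
    ; os-range = λ e∈ → case ∈-map⁻ uncolour e∈ of λ
        { (edge _ _ _ , e∈ , refl) → os-range e∈ }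
    ; total    = λ {i} {j} j<i i<k ij → case uncoloured⁻ {col (f i) (f j)} ij of λ
        { (refl , d , r) → case total j<i i<k r of λ
          { (inj₁ e∈) → inj₁ (∈-map⁺ uncolour e∈)
          ; (inj₂ e∈) → inj₂ (∈-map⁺ uncolour e∈) } }
    }
    where open Valid V

  Goal : Set
  Goal = Uncoloured.Accepted accept

  Sound : (ℕ → List Edge → List Edge → Bool) → Set
  Sound go = ∀ {k es os f} → T (go k es os) → Valid k es os f → Goal

  -- If some relevant undecided edge is present, one of the `branches` applies. Otherwise no edge
  -- between named vertices is exposed, so the edge from `exposedEdge` leads to a vertex without a
  -- name, and `attach` applies.
  step-sound : ∀ go → Sound go → ∀ {k es os f} A →
               T (step go k es os A) → Valid k es os f → Goal
  step-sound go go-sound {k} nothing t V with ∧⁻ {k ≡ᵇ 8} t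
  ... | k≡8 , t′ with ℕ.≡ᵇ⇒≡ k 8 k≡8
  ...   | refl = Uncoloured.complete-sound accept 57 t′ (forget V)
  step-sound go go-sound {k} {es} {os} {f} (just A@((p , t₀) ∷ A′)) t V
    with ∧⁻ {all (λ l → proj₁ l <ᵇ k) A} t
  ... | bounds , t₁ with ∧⁻ {not (any (relevant A) es)} t₁
  ... | clean , t₂ with ∧⁻ {branches (go k) es (filterᵇ (relevant A) os) os} t₂
  ... | t₃ , t₄ with Any.any? (real? f) (filterᵇ (relevant A) os)
  ... | yes r = branches-sound TF (go k) go-sound (filterᵇ (relevant A) os) t₃ V
                  (os-range ∘ proj₁ ∘ ∈-filterᵇ⁻ (relevant A)) r
    where open Valid V
  ... | no none = byExposed
      (exposedEdge crit val (member p<k) (trans (val-name p<k) (value-here p t₀ A′)))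
    where
    open Valid V

    named? : ∀ u → Dec (∃ λ i → i < k × f i ≡ u)
    named? u = ℕ.anyUpTo? (λ i → f i ≟ u) k

    val : Fin n → Maybe Bool
    val u with named? u
    ... | yes (i , _) = value A i
    ... | no _        = nothing

    val-name : ∀ {i} → i < k → val (f i) ≡ value A i
    val-name {i} i<k with named? (f i)
    ... | yes (j , j<k , eq) = cong (value A) (injective j<k i<k eq)
    ... | no ¬named          = contradiction (i , i<k , refl) ¬named

    val⁻ : ∀ {u s} → val u ≡ just s → ∃ λ i → i < k × f i ≡ u × value A i ≡ just s
    val⁻ {u} eq with named? u
    ... | yes (i , i<k , fi≡u) = i , i<k , fi≡u , eq

    bound : ∀ {q s} → (q , s) ∈ₗ A → q < k
    bound {q} l∈ = ℕ.<ᵇ⇒< q k (All.lookup (All.all⁺ (λ l → proj₁ l <ᵇ k) A bounds) l∈)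

    p<k : p < k
    p<k = bound (here refl)

    irrelevant : ∀ {i j c} → j < i → i < k → Real f (edge i j c) → ¬ T (relevant A (edge i j c))
    irrelevant j<i i<k r rel with total j<i i<k r
    ... | inj₁ e∈ = not⁻ clean (any⁺ (relevant A) (lose e∈ rel))
    ... | inj₂ e∈ = none (lose (∈-filterᵇ⁺ (relevant A) e∈ rel) r)

    byName : ∀ {i s w} → f i ∈ U → w ∈ U → col (f i) w ≡ just s → val w ≢ just (not s) →
             i < k → value A i ≡ just s → Dec (∃ λ j → j < k × f j ≡ w) → Goal
    byName {i} {s} u∈U w∈U uw val-w i<k i↦s (yes (j , j<k , refl)) = ⊥-elim (impossible (ℕ.<-cmp j i))
      where
      j↦ : value A j ≢ just (not s)
      j↦ eq = val-w (trans (val-name j<k) eq)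

      impossible : _ → ⊥
      impossible (tri< j<i _ _)  = irrelevant j<i i<k uw
        (Equivalence.from T-∨ (inj₁ (clash⁺ i↦s j↦)))
      -- `triangle` allows equal vertices and thereby excludes loops.
      impossible (tri≈ _ refl _) = triangle u∈U u∈U u∈U uw uw uw
      impossible (tri> _ _ i<j)  = irrelevant i<j j<k (swap uw)
        (Equivalence.from (T-∨ {clash s (value A j) (value A i)}) (inj₂ (clash⁺ i↦s j↦)))
    byName {i} {s} {w} u∈U w∈U uw val-w i<k i↦s (no ¬named) = byNew (∨⁻ {k ≡ᵇ 8} t₄)
      where
      rest : List Edge
      rest = filterᵇ (not ∘ relevant A) os

      V′ : Valid (suc k) es (fresh k ++ rest) (f [ k ≔ w ])
      V′ = addVertex
        (discard (not ∘ relevant A) V λ { (edge i j c) e∈ r →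
          let j<i , i<k = os-range e∈ in not⁺ (irrelevant j<i i<k r) })
        w∈U λ {m} m<k eq → ¬named (m , m<k , eq)

      byNew : T (k ≡ᵇ 8) ⊎ T (all (attach go k es rest) A) → Goal
      byNew (inj₁ k≡8) with ℕ.≡ᵇ⇒≡ k 8 k≡8
      -- Eight elements of U are named already, so w would be a ninth.
      ... | refl = contradiction (ℕ.≤-trans (Valid.k≤∣S∣ V′) ∣U∣≤8) ℕ.1+n≰n
      byNew (inj₂ t₅) = go-sound
        (All.lookup (All.all⁺ (attach go k es rest) A t₅) (value-∈ A i↦s))
        (addEdge V′ i<k (ℕ.n<1+n k)
          (trans (cong₂ col (update-new f k w) (update-old f w i<k)) (swap uw)))

    byExposed : (∃ λ u → ∃₂ (Exposed U val u)) → Goal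
    byExposed (u , w , s , u∈U , w∈U , val-u , uw , val-w) =
      let i , i<k , fi≡u , i↦s = val⁻ val-u in
      byName (subst (_∈ U) (sym fi≡u) u∈U) w∈U
        (subst (λ u → col u w ≡ just s) (sym fi≡u) uw) val-w i<k i↦s (named? w)

  search-sound : ∀ m → Sound (search m)
  search-sound (suc m) {k} {es} {os} = step-sound (search m) (search-sound m) (select k es os)

-- Recognition of the graphs N₈ i

walksFrom : List Edge → ℕ → ℕ → ℕ
walksFrom es zero    p = 1
walksFrom es (suc m) p = go es
  where
  go : List Edge → ℕ
  go []                = 0
  go (edge i j _ ∷ xs) =
    if p ≡ᵇ i then walksFrom es m j + go xs else
    if p ≡ᵇ j then walksFrom es m i + go xs else go xs

-- Adjacency matrices, with the numbers of walks used to narrow down the candidates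
-- for the image of a vertex.
Target : Set
Target = Vec (ℕ × Vec Bool 8) 8

target : Fin 7 → Target
target i = tabulate λ u → walks (N₈ i) 3 u , tabulate (adj (N₈ i) u)

-- An embedding of the graph on the first k names as an induced subgraph. The pairs with j < i
-- determine the others by symmetry.
record Fits (A : Fin 8 → Fin 8 → Bool) (es : List Edge) (k : ℕ) (π : ℕ → Fin 8) : Set where
  field
    distinct : ∀ {i j} → j < i → i < k → π i ≢ π j
    respects : ∀ {i j} → j < i → i < k → adjacent es i j ≡ A (π i) (π j)

module _ (M : Target) (es : List Edge) where
  row : Fin 8 → Fin 8 → Bool
  row u = lookup (proj₂ (lookup M u))

  agrees : ℕ → (ℕ → Fin 8) → Fin 8 → ℕ → Bool
  agrees k π u j = not (toℕ u ≡ᵇ toℕ (π j)) ∧ (adjacent es k j == row u (π j))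

  -- Backtracking: names are placed in increasing order, each compared with all earlier ones. The
  -- list holds the walk numbers of the names from k on.
  matches : ℕ → List ℕ → (ℕ → Fin 8) → Bool

  place : ℕ → ℕ → List ℕ → (ℕ → Fin 8) → Fin 8 → Bool
  place k w ws π u =
    (w ≡ᵇ proj₁ (lookup M u)) ∧ all (agrees k π u) (downFrom k) ∧
    matches (suc k) ws (π [ k ≔ u ])

  matches k []       π = true
  matches k (w ∷ ws) π = any (place k w ws π) (allFin 8)

  matches-sound : ∀ k ws {π} → T (matches k ws π) → Fits row es k π →
                  ∃ (Fits row es (length ws + k))
  matches-sound k []       _ F = _ , F
  matches-sound k (w ∷ ws) {π} t F with find (any⁻ (place k w ws π) (allFin 8) t)
  ... | u , _ , t₁ with ∧⁻ {w ≡ᵇ proj₁ (lookup M u)} t₁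
  ... | _ , t₂ with ∧⁻ {all (agrees k π u) (downFrom k)} t₂
  ... | ok , t₃ with matches-sound (suc k) ws t₃ F′
    where
    open Fits F

    agree : ∀ {j} → j < k → T (not (toℕ u ≡ᵇ toℕ (π j))) × T (adjacent es k j == row u (π j))
    agree {j} j<k = ∧⁻ {not (toℕ u ≡ᵇ toℕ (π j))}
      (All.lookup (All.all⁺ (agrees k π u) (downFrom k) ok) (∈-downFrom⁺ j<k))

    F′ : Fits row es (suc k) (π [ k ≔ u ])
    F′ = record { distinct = d ; respects = e }
      where
      d : ∀ {i j} → j < i → i < suc k → (π [ k ≔ u ]) i ≢ (π [ k ≔ u ]) j
      d {i} {j} j<i i<1+k eq with ℕ.m<1+n⇒m<n∨m≡n i<1+k
      ... | inj₁ i<k  = distinct j<i i<k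
                          (subst₂ _≡_ (update-old π u i<k) (update-old π u (ℕ.<-trans j<i i<k)) eq)
      ... | inj₂ refl = not⁻ (proj₁ (agree j<i)) (ℕ.≡⇒≡ᵇ _ _ (cong toℕ
                          (subst₂ _≡_ (update-new π i u) (update-old π u j<i) eq)))

      e : ∀ {i j} → j < i → i < suc k →
          adjacent es i j ≡ row ((π [ k ≔ u ]) i) ((π [ k ≔ u ]) j)
      e {i} {j} j<i i<1+k with ℕ.m<1+n⇒m<n∨m≡n i<1+k
      ... | inj₁ i<k  = trans (respects j<i i<k)
                          (sym (cong₂ row (update-old π u i<k) (update-old π u (ℕ.<-trans j<i i<k))))
      ... | inj₂ refl = trans (==-sound (proj₂ (agree j<i)))
                          (sym (cong₂ row (update-new π i u) (update-old π u j<i)))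
  ... | π′ , F″ = π′ , subst (λ m → Fits row es m π′) (ℕ.+-suc (length ws) k) F″

matchesSome : Vec Target 7 → List Edge → List ℕ → Bool
-- The constant map `0F` is a placeholder, since no name is placed yet.
matchesSome C es ws = any (λ i → matches (lookup C i) es 0 ws (λ _ → 0F)) (allFin 7)

-- The list ws stays a variable, since matches unfolds to a huge term otherwise.
matchesSome-sound : ∀ C es ws → T (matchesSome C es ws) →
                    ∃₂ λ i → Fits (row (lookup C i) es) es (length ws + 0)
matchesSome-sound C es ws t
  with find (any⁻ (λ i → matches (lookup C i) es 0 ws (λ _ → 0F)) (allFin 7) t)
... | i , _ , t′ =
  i , matches-sound (lookup C i) es 0 ws t′ (record { distinct = λ _ () ; respects = λ _ () })

row-target : ∀ i es u w → row (lookup (tabulate target) i) es u w ≡ adj (N₈ i) u w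
row-target i es u w = trans
  (cong (λ M → row M es u w) (lookup∘tabulate target i))
  (trans
    (cong (λ r → lookup (proj₂ r) w)
          (lookup∘tabulate (λ u → walks (N₈ i) 3 u , tabulate (adj (N₈ i) u)) u))
    (lookup∘tabulate (adj (N₈ i) u) w))

-- Copies of the seven graphs in a neighbourhood

module _ {n} (G : Graph (Fin n)) where

  -- The embedding is a vector, so that its existence is decidable and `copyFound` may argue by
  -- contradiction.
  Copy : Fin n → Fin 7 → Vec (Fin n) 8 → Set
  Copy v i h = (∀ a b → lookup h a ≡ lookup h b → a ≡ b) ×
               (∀ a → lookup h a ∈ neighbours G v) ×
               (∀ a b → adj G (lookup h a) (lookup h b) ≡ adj (N₈ i) a b)

  copy? : ∀ v i h → Dec (Copy v i h)
  copy? v i h =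
    (Fin.all? λ a → Fin.all? λ b → (lookup h a ≟ lookup h b) →-dec (a ≟ b)) ×-dec
    (Fin.all? λ a → lookup h a ∈? neighbours G v) ×-dec
    (Fin.all? λ a → Fin.all? λ b → adj G (lookup h a) (lookup h b) Bool.≟ adj (N₈ i) a b)

  Contains : Fin n → Set
  Contains v = ∃₂ (Copy v)

anyVec? : ∀ {n} k {P : Vec (Fin n) k → Set} → (∀ xs → Dec (P xs)) → Dec (∃ P)
anyVec? zero    P? = map′ (λ p → [] , p) (λ { ([] , p) → p }) (P? [])
anyVec? (suc k) P? = map′ (λ { (x , xs , p) → x ∷ xs , p }) (λ { (x ∷ xs , p) → x , xs , p })
  (Fin.any? λ x → anyVec? k λ xs → P? (x ∷ xs))

contains? : ∀ {n} (G : Graph (Fin n)) v → Dec (Contains G v)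
contains? G v = Fin.any? λ i → anyVec? 8 (copy? G v i)

copy⇒8≤degree : ∀ {n} (G : Graph (Fin n)) {v} → Contains G v → 8 ≤ degree G v
copy⇒8≤degree G {v} (i , h , inj , mem , _) =
  ∣S∣-lower-bound 8 (neighbours G v) (lookup h) (inj _ _) mem

-- A copy fills a neighbourhood of 8 vertices, so its embedding is a bijection.
copy⇒≅ : ∀ {n} (G : Graph (Fin n)) {v} → degree G v ≡ 8 → Contains G v →
         ∃ λ i → G ⟨ v ⟩ ≅ N₈ i
copy⇒≅ G {v} d≡8 (i , h , inj , mem , eq) = i , record
  { bijection = mk↔ₛ′ to from to∘from from∘to
  ; preserves = λ x y → trans (cong₂ (adj G) (sym (hit x)) (sym (hit y))) (eq (to x) (to y))
  }
  where
  onto : ∀ {x} → x ∈ neighbours G v → ∃ λ a → lookup h a ≡ x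
  onto = injective⇒surjective (lookup h) (inj _ _) mem (ℕ.≤-reflexive d≡8)

  to : ∃ (_∈ neighbours G v) → Fin 8
  to (x , x∈) = proj₁ (onto x∈)

  hit : ∀ x → lookup h (to x) ≡ proj₁ x
  hit (x , x∈) = proj₂ (onto x∈)

  from : Fin 8 → ∃ (_∈ neighbours G v)
  from a = lookup h a , mem a

  to∘from : ∀ a → to (from a) ≡ a
  to∘from a = inj _ _ (hit (from a))

  ∈-ext : ∀ {x y : ∃ (_∈ neighbours G v)} → proj₁ x ≡ proj₁ y → x ≡ y
  ∈-ext {x , p} {_ , q} refl = cong (x ,_) ([]=-irrelevant p q)

  from∘to : ∀ x → from (to x) ≡ x
  from∘to x = ∈-ext (hit x)

-- Adjacency and cliques

¬Adj-refl : ∀ {V} (G : Graph V) {v} → ¬ Adj G v v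
¬Adj-refl G {v} e = subst T (adj-irrefl G v) e

Adj-sym : ∀ {V} (G : Graph V) {u v} → Adj G u v → Adj G v u
Adj-sym G {u} {v} = subst T (adj-sym G u v)

∈-neighbours⁻ : ∀ {n} (G : Graph (Fin n)) {v u} → u ∈ neighbours G v → Adj G v u
∈-neighbours⁻ G {v} {u} u∈ = ≡⇒T (trans (sym (lookup∘tabulate (adj G v) u)) ([]=⇒lookup u∈))

∈-neighbours⁺ : ∀ {n} (G : Graph (Fin n)) {v u} → Adj G v u → u ∈ neighbours G v
∈-neighbours⁺ G {v} {u} e = lookup⇒[]= u (neighbours G v)
  (trans (lookup∘tabulate (adj G v) u) (Equivalence.to T-≡ e))

-- Since x is not adjacent to itself, it lies outside S, and the size grows.
clique-∪ : ∀ {n} (G : Graph (Fin n)) {S x k} →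
           IsClique G S → k ≤ ∣ S ∣ → (∀ u → u ∈ S → Adj G x u) →
           IsClique G (S ∪ ⁅ x ⁆) × suc k ≤ ∣ S ∪ ⁅ x ⁆ ∣
clique-∪ G {S} {x} cl k≤ nbr = cl′ , ℕ.≤-trans (s≤s k≤) (p⊂q⇒∣p∣<∣q∣
  ((λ u∈ → x∈p∪q⁺ (inj₁ u∈)) , x , x∈p∪q⁺ (inj₂ (x∈⁅x⁆ x)) , λ x∈S → ¬Adj-refl G (nbr x x∈S)))
  where
  cl′ : IsClique G (S ∪ ⁅ x ⁆)
  cl′ u w u∈ w∈ u≢w with x∈p∪q⁻ S ⁅ x ⁆ u∈ | x∈p∪q⁻ S ⁅ x ⁆ w∈
  ... | inj₁ u∈S | inj₁ w∈S = cl u w u∈S w∈S u≢w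
  ... | inj₁ u∈S | inj₂ w∈x with x∈⁅y⁆⇒x≡y x w∈x
  ...   | refl = Adj-sym G (nbr u u∈S)
  cl′ u w u∈ w∈ u≢w | inj₂ u∈x | inj₁ w∈S with x∈⁅y⁆⇒x≡y x u∈x
  ...   | refl = nbr w w∈S
  cl′ u w u∈ w∈ u≢w | inj₂ u∈x | inj₂ w∈x =
    contradiction (trans (x∈⁅y⁆⇒x≡y x u∈x) (sym (x∈⁅y⁆⇒x≡y x w∈x))) u≢w

-- Starting from `∅`, the clique gains one vertex at a time until its size exceeds 3.
no-K₄ : ∀ {n} (G : Graph (Fin n)) → CliqueNumber G 3 → ∀ {a b c d} →
        Adj G a b → Adj G a c → Adj G a d → Adj G b c → Adj G b d → Adj G c d → ⊥
no-K₄ G ω {a} {b} {c} {d} ab ac ad bc bd cd =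
  let cl₁ , s₁ = clique-∪ G {∅} {a} {0} (λ u w u∈ → contradiction u∈ ∉⊥) z≤n
                   (λ u u∈ → contradiction u∈ ∉⊥)
      cl₂ , s₂ = clique-∪ G cl₁ s₁ (join {S = ∅} ab λ u u∈ → contradiction u∈ ∉⊥)
      cl₃ , s₃ = clique-∪ G cl₂ s₂ (join bc (join {S = ∅} ac λ u u∈ → contradiction u∈ ∉⊥))
      cl₄ , s₄ = clique-∪ G cl₃ s₃
                   (join cd (join bd (join {S = ∅} ad λ u u∈ → contradiction u∈ ∉⊥)))
  in contradiction (ℕ.≤-trans s₄ (CliqueNumber.maximal ω _ cl₄)) ℕ.1+n≰n
  where
  join : ∀ {S y x} → Adj G y x → (∀ u → u ∈ S → Adj G x u) → ∀ u → u ∈ S ∪ ⁅ y ⁆ → Adj G x u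
  join {S} {y} yx nbr u u∈ with x∈p∪q⁻ S ⁅ y ⁆ u∈
  ... | inj₁ u∈S = nbr u u∈S
  ... | inj₂ u∈y with x∈⁅y⁆⇒x≡y y u∈y
  ...   | refl = Adj-sym G yx

-- Extension of a colouring of G − v

module _ {n} (G : Graph (Fin n)) (ω : CliqueNumber G 3) (v : Fin n) where

  others : Subset n
  others = ∁ ⁅ v ⁆

  ∈-others : ∀ {u} → u ≢ v → u ∈ others
  ∈-others u≢v = x∉p⇒x∈∁p (x≢y⇒x∉⁅y⁆ u≢v)

  G-v : Subgraph G
  G-v = record { vertices = others ; graph = induced G others ; edges = λ _ _ e → e }

  neighbour≢ : ∀ {u} → u ∈ neighbours G v → u ≢ v
  neighbour≢ u∈ refl = ¬Adj-refl G (∈-neighbours⁻ G u∈)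

  module _ (c : Colouring (induced G others)) where

    -- A total function on pairs, `nothing` at v and on non-edges, keeps membership and adjacency
    -- proofs out of the search.
    col : Fin n → Fin n → Maybe Bool
    col u w with u ∈? others | w ∈? others | T? (adj G u w)
    ... | yes u∈ | yes w∈ | yes e = just (colour c (u , u∈) (w , w∈) e)
    ... | _      | _      | _     = nothing

    col⁻ : ∀ {u w b} → col u w ≡ just b → Adj G u w
    col⁻ {u} {w} eq with u ∈? others | w ∈? others | T? (adj G u w)
    ... | yes _ | yes _ | yes e = e

    col⁺ : ∀ {u w} (u∈ : u ∈ others) (w∈ : w ∈ others) (e : Adj G u w) →
           col u w ≡ just (colour c (u , u∈) (w , w∈) e)
    col⁺ {u} {w} u∈ w∈ e with u ∈? others | w ∈? others | T? (adj G u w)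
    ... | no u∉ | _     | _     = contradiction u∈ u∉
    ... | yes _ | no w∉ | _     = contradiction w∈ w∉
    ... | yes _ | yes _ | no ¬e = contradiction e ¬e
    ... | yes u∈′ | yes w∈′ | yes e′
      rewrite []=-irrelevant u∈′ u∈ | []=-irrelevant w∈′ w∈ | T-irrelevant e′ e = refl

    col-sym : ∀ u w → col u w ≡ col w u
    col-sym u w with u ∈? others | w ∈? others | T? (adj G u w) | T? (adj G w u)
    ... | yes u∈ | yes w∈ | yes e | yes e′ = cong just (colour-sym c _ _ e e′)
    ... | yes _  | yes _  | yes e | no ¬e′ = contradiction (Adj-sym G e) ¬e′
    ... | yes _  | yes _  | no ¬e | yes e′ = contradiction (Adj-sym G e′) ¬e
    ... | yes _  | yes _  | no _  | no _   = refl
    ... | yes _  | no _   | _     | _      = refl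
    ... | no _   | yes _  | _     | _      = refl
    ... | no _   | no _   | _     | _      = refl

    -- A triangle among the neighbours of v would form a clique of size 4 with v.
    col-triangleFree : ∀ {U} → U ⊆ neighbours G v → TriangleFreeOn U col
    col-triangleFree U⊆ = record
      { col-sym  = col-sym
      ; triangle = λ u∈ v∈ w∈ uv vw uw → no-K₄ G ω
          (∈-neighbours⁻ G (U⊆ u∈)) (∈-neighbours⁻ G (U⊆ v∈)) (∈-neighbours⁻ G (U⊆ w∈))
          (col⁻ uv) (col⁻ uw) (col⁻ vw)
      }

    open Coloured col col-sym

    -- The edges at v are coloured by their parts. A monochromatic triangle through v would violate
    -- the splitting, so the one that G must have lies in G - v.
    extend : (x : Fin n → Bool) → Splits x (neighbours G v) → Ramsey G → MonochromaticTriangle c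
    extend x split ramsey = fromG (ramsey c⁺)
      where
      paint : Fin n → Fin n → Bool
      paint u w with u ≟ v | w ≟ v
      ... | yes _ | _     = x w
      ... | no _  | yes _ = x u
      -- The default `false` is taken on non-edges only.
      ... | no _  | no _  = fromMaybe false (col u w)

      paint-sym : ∀ u w → Adj G u w → paint u w ≡ paint w u
      paint-sym u w e with u ≟ v | w ≟ v
      ... | yes refl | yes refl = refl
      ... | yes _    | no _     = refl
      ... | no _     | yes _    = refl
      ... | no _     | no _     = cong (fromMaybe false) (col-sym u w)

      c⁺ : Colouring G
      c⁺ = record { colour = λ u w _ → paint u w ; colour-sym = λ u w e _ → paint-sym u w e }

      through-v : ∀ {u w} → Adj G v u → Adj G v w → Adj G u w →
                  x u ≡ x w → fromMaybe false (col u w) ≡ x u → ⊥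
      through-v {u} {w} vu vw uw x≡ c≡ = split u w u∈ w∈
        (trans eq (cong just (trans (sym (cong (fromMaybe false) eq)) c≡))) x≡
        where
        u∈ = ∈-neighbours⁺ G vu
        w∈ = ∈-neighbours⁺ G vw
        eq = col⁺ (∈-others (neighbour≢ u∈)) (∈-others (neighbour≢ w∈)) uw

      mono : ∀ u w z → Adj G u w → Adj G w z → Adj G u z →
             paint u w ≡ paint w z → paint u w ≡ paint u z → MonochromaticTriangle c
      mono u w z uw wz uz p q with u ≟ v | w ≟ v | z ≟ v
      ... | yes refl | yes refl | _        = ⊥-elim (¬Adj-refl G uw)
      ... | yes refl | no _     | yes refl = ⊥-elim (¬Adj-refl G uz)
      ... | yes refl | no _     | no _     = ⊥-elim (through-v uw uz wz q (sym p))
      ... | no _     | yes refl | yes refl = ⊥-elim (¬Adj-refl G wz)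
      ... | no _     | yes refl | no _     = ⊥-elim (through-v (Adj-sym G uw) wz uz p (sym q))
      ... | no _     | no _     | yes refl =
        ⊥-elim (through-v (Adj-sym G uz) (Adj-sym G wz) uw (trans (sym q) p) q)
      ... | no u≢v   | no w≢v   | no z≢v   =
        (u , u∈) , (w , w∈) , (z , z∈) , uw , wz , uz ,
        same u∈ w∈ uw w∈ z∈ wz p , same u∈ w∈ uw u∈ z∈ uz q
        where
        u∈ = ∈-others u≢v
        w∈ = ∈-others w≢v
        z∈ = ∈-others z≢v

        same : ∀ {u w u′ w′} (u∈ : u ∈ others) (w∈ : w ∈ others) (e : Adj G u w)
               (u′∈ : u′ ∈ others) (w′∈ : w′ ∈ others) (e′ : Adj G u′ w′) →
               fromMaybe false (col u w) ≡ fromMaybe false (col u′ w′) →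
               colour c (u , u∈) (w , w∈) e ≡ colour c (u′ , u′∈) (w′ , w′∈) e′
        same u∈ w∈ e u′∈ w′∈ e′ eq = trans (sym (cong (fromMaybe false) (col⁺ u∈ w∈ e)))
                                      (trans eq (cong (fromMaybe false) (col⁺ u′∈ w′∈ e′)))

      fromG : MonochromaticTriangle c⁺ → MonochromaticTriangle c
      fromG (u , w , z , uw , wz , uz , p , q) = mono u w z uw wz uz p q

    -- While accept and m are variables, Agda cannot run the search.
    module _ (accept : List Edge → Bool)
             (accept-sound : ∀ {es} → T (accept es) → ∃₂ λ i → Fits (adj (N₈ i)) es 8)
             (m : ℕ) (succeeds : Search.search accept m 1 [] [] ≡ true) where

      unsplittable⇒copy : degree G v ≤ 8 → ¬ Splittable (neighbours G v) → Contains G v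
      unsplittable⇒copy d≤8 unsplit
        with criticalSubset _ (neighbours G v) ℕ.≤-refl unsplit
      ... | U , U⊆ , crit with nonempty? U
      -- The empty set splits trivially, so a critical set has a vertex from which the search can
      -- start.
      ...   | no empty = contradiction
                ((λ _ → true) , λ u _ u∈ → contradiction (u , u∈) empty)
                (Critical.unsplittable crit)
      ...   | yes (u₀ , u₀∈U) = fromAccepted
                (search-sound m (≡⇒T succeeds) start)
        where
        TF : TriangleFreeOn U col
        TF = col-triangleFree U⊆

        ∣U∣≤8 : ∣ U ∣ ≤ 8
        ∣U∣≤8 = ℕ.≤-trans (p⊆q⇒∣p∣≤∣q∣ U⊆) d≤8

        open SearchSound TF crit ∣U∣≤8 accept using (module Uncoloured; search-sound)

        start : Naming.Valid U col TF 1 [] [] (λ _ → u₀)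
        start = record
          { names    = record { injective = λ { (s≤s z≤n) (s≤s z≤n) _ → refl } ; member = λ _ → u₀∈U }
          ; es-real  = λ ()
          ; os-range = λ ()
          ; total    = λ { () (s≤s z≤n) _ }
          }

        fromFits : ∀ {i es f π} →
          Uncoloured.Valid 8 es [] f → Fits (adj (N₈ i)) es 8 π → Contains G v
        fromFits {i} {es} {f} {π} V F = i , tabulate g , inj , mem , eq
          where
          open Uncoloured.Valid V using (member; toFin-injective; total)
          open Fits F

          agree-< : ∀ {i′ j′} → j′ < i′ → i′ < 8 → adj G (f i′) (f j′) ≡ adj (N₈ i) (π i′) (π j′)
          agree-< {i′} {j′} j<i i<8 = trans (⇔→≡ (mk⇔ to from)) (respects j<i i<8)
            where
            others∋ : ∀ {m} → m < 8 → f m ∈ others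
            others∋ m<8 = ∈-others (neighbour≢ (U⊆ (member m<8)))

            to : adj G (f i′) (f j′) ≡ true → adjacent es i′ j′ ≡ true
            to eq with total j<i i<8 (cong (Maybe.map (λ _ → true))
                         (col⁺ (others∋ i<8) (others∋ (ℕ.<-trans j<i i<8)) (≡⇒T eq)))
            ... | inj₁ e∈ = Equivalence.to T-≡ (Uncoloured.adjacent-complete e∈)

            from : adjacent es i′ j′ ≡ true → adj G (f i′) (f j′) ≡ true
            from eq = Equivalence.to T-≡ (col⁻ (proj₂ (proj₂ (uncoloured⁻ {col (f i′) (f j′)}
                        (proj₂ (Uncoloured.adjacent-sound V (≡⇒T eq)))))))

          agree : ∀ {i′ j′} → i′ < 8 → j′ < 8 → adj G (f i′) (f j′) ≡ adj (N₈ i) (π i′) (π j′)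
          agree {i′} {j′} i<8 j<8 with ℕ.<-cmp i′ j′
          ... | tri< i<j _ _  =
            trans (adj-sym G _ _) (trans (agree-< i<j j<8) (adj-sym (N₈ i) (π j′) (π i′)))
          ... | tri≈ _ refl _ = trans (adj-irrefl G _) (sym (adj-irrefl (N₈ i) (π i′)))
          ... | tri> _ _ j<i  = agree-< j<i i<8

          π-injective : ∀ {a b : Fin 8} → π (toℕ a) ≡ π (toℕ b) → a ≡ b
          π-injective {a} {b} eq with ℕ.<-cmp (toℕ a) (toℕ b)
          ... | tri< a<b _ _ = contradiction (sym eq) (distinct a<b (Fin.toℕ<n b))
          ... | tri≈ _ a≡b _ = Fin.toℕ-injective a≡b
          ... | tri> _ _ b<a = contradiction eq (distinct b<a (Fin.toℕ<n a))

          -- By counting, the injective π is onto; inverting it renumbers the named vertices by the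
          -- labels of `N₈ i`.
          label : (a : Fin 8) → ∃ λ b → π (toℕ b) ≡ a
          label a = injective⇒surjective {S = ⊤} (π ∘ toℕ) π-injective (λ _ → ∈⊤)
            (ℕ.≤-reflexive (∣⊤∣≡n 8)) ∈⊤

          g : Fin 8 → Fin n
          g a = f (toℕ (proj₁ (label a)))

          look : ∀ a → lookup (tabulate g) a ≡ g a
          look = lookup∘tabulate g

          inj : ∀ a b → lookup (tabulate g) a ≡ lookup (tabulate g) b → a ≡ b
          inj a b e = trans (sym (proj₂ (label a))) (trans
            (cong (π ∘ toℕ) (toFin-injective (trans (sym (look a)) (trans e (look b))))) (proj₂ (label b)))

          mem : ∀ a → lookup (tabulate g) a ∈ neighbours G v
          mem a = subst (_∈ neighbours G v) (sym (look a)) (U⊆ (member (Fin.toℕ<n (proj₁ (label a)))))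

          eq : ∀ a b → adj G (lookup (tabulate g) a) (lookup (tabulate g) b) ≡ adj (N₈ i) a b
          eq a b = trans (cong₂ (adj G) (look a) (look b)) (trans
            (agree (Fin.toℕ<n (proj₁ (label a))) (Fin.toℕ<n (proj₁ (label b))))
            (cong₂ (adj (N₈ i)) (proj₂ (label a)) (proj₂ (label b))))

        fromAccepted : Uncoloured.Accepted accept → Contains G v
        fromAccepted (es , f , V , ok) =
          let i , π , F = accept-sound {es} ok in fromFits {i} {es} {f} {π} V F

  -- Without a copy, every colouring of G - v would split G(v) and hence have a monochromatic
  -- triangle by `extend`. Then G - v would be Ramsey, against minimality.
  copyFound : (accept : List Edge → Bool) →
    (∀ {es} → T (accept es) → ∃₂ λ i → Fits (adj (N₈ i)) es 8) →
    ∀ m → Search.search accept m 1 [] [] ≡ true →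
    MinimalRamsey G → degree G v ≤ 8 → Contains G v
  copyFound accept accept-sound m succeeds minimalG d≤8 =
    decidable-stable (contains? G v) λ none →
    minimal G-v (inj₁ (v , x∈p⇒x∉∁p (x∈⁅x⁆ v))) λ c →
      case Coloured.splittable? (col c) (col-sym c) (neighbours G v) of λ
        { (yes (x , split)) → extend c x split ramsey
        ; (no unsplit)      → contradiction
            (unsplittable⇒copy c accept accept-sound m succeeds d≤8 unsplit) none }
    where open MinimalRamsey minimalG

-- Running the search and deducing the theorem

recognise : Vec Target 7 → List Edge → Bool
recognise C es = matchesSome C es (map (walksFrom es 3) (upTo 8))

accept : List Edge → Bool
accept = recognise (tabulate target)

accept-sound : ∀ {es} → T (accept es) → ∃₂ λ i → Fits (adj (N₈ i)) es 8
accept-sound {es} t =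
  let i , π , F = matchesSome-sound (tabulate target) es (map (walksFrom es 3) (upTo 8)) t
  in i , π , record
    { distinct = Fits.distinct F
    ; respects = λ j<i i<8 → trans (Fits.respects F j<i i<8) (row-target i es _ _) }

-- The evidence refl runs the search.
copyAt : ∀ {n} (G : Graph (Fin n)) → CliqueNumber G 3 → ∀ v →
         MinimalRamsey G → degree G v ≤ 8 → Contains G v
copyAt G ω v = copyFound G ω v accept accept-sound 40 refl

-- A neighbourhood with fewer than 8 vertices would still contain a copy of a graph with 8 vertices.
8≤degree : ∀ {n} (G : Graph (Fin n)) → MinimalRamsey G → CliqueNumber G 3 → ∀ v → 8 ≤ degree G v
8≤degree G minimalG ω v with 8 ℕ.≤? degree G v
... | yes 8≤d = 8≤d
... | no 8≰d  = copy⇒8≤degree G (copyAt G ω v minimalG (ℕ.<⇒≤ (ℕ.≰⇒> 8≰d)))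

someVertex : ∀ {n} {G : Graph (Fin n)} → CliqueNumber G 3 → Fin n
someVertex {zero} ω with CliqueNumber.attained ω
... | [] , _ , ()
someVertex {suc n} ω = zero

theorem8p2 : (n : ℕ) (G : Graph (Fin n)) → MinimalRamsey G → CliqueNumber G 3 →
    (δ G ≥ 8) × (∀ (v : Fin n) → degree G v ≡ 8 → ∃ λ (i : Fin 7) → (G ⟨ v ⟩) ≅ N₈ i)
theorem8p2 n G minimalG ω =
  -- The default n of the minimum must be at least 8 too: it bounds the degree of some vertex, which
  -- exists because G has a clique of size 3.
  v≤min⁺ (ℕ.≤-trans (8≤ (someVertex ω)) (∣p∣≤n (neighbours G (someVertex ω))))
         (All.map⁺ (All.universal 8≤ (allFin n))) ,
  λ v d≡8 → copy⇒≅ G d≡8 (copyAt G ω v minimalG (ℕ.≤-reflexive d≡8))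
  where 8≤ = 8≤degree G minimalG ω
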